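{- For any ${\rm LP}^{\rm MLN}$ program $\mathsf F$, a set $X$ of atoms is a soft stable model of $\mathsf F$ if and only if $X$ is a (standard) stable model of $\{\overline{\mathsf F}\}^{\rm ch}$.
   Context: Propositional formulas are built from atoms and $\bot$ using $\land,\lor,\rightarrow$, with $\neg F$ standing for $F\rightarrow\bot$ and $\top$ for $\bot\rightarrow\bot$. An interpretation is identified with the set of atoms true in it; $X\models R$ is classical satisfaction. The reduct $F^X$ is obtained from $F$ by replacing every maximal subformula not (classically) satisfied by $X$ with $\bot$; for a set $\Gamma$ of formulas, $\Gamma^X=\{F^X\mid F\in\Gamma\}$. $X$ is a (standard) stable model of $\Gamma$ if $X$ is a minimal model (with respect to inclusion) of $\Gamma^X$. An ${\rm LP}^{\rm MLN}$ program is a finite set of weighted formulas $w:R$, where $R$ is a propositional formula and $w$ is a real number or the symbol $\alpha$ (infinite weight). $\overline{\mathsf F}$ is the set of formulas obtained from $\mathsf F$ by dropping weights, and $\mathsf F_X$ is the set of those $w:R$ in $\mathsf F$ with $X\models R$. $X$ is a soft stable model of $\mathsf F$ if $X$ is a stable model of $\overline{\mathsf F_X}$. For a formula $F$, $\{F\}^{\rm ch}$ denotes $F\lor\neg F$, and $\{\Gamma\}^{\rm ch}=\{\{F\}^{\rm ch}\mid F\in\Gamma\}$ for a set $\Gamma$ of formulas. -}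

module Defs where

open import Data.Bool using (Bool; T; T?; if_then_else_)
open import Data.Empty using (⊥)
open import Data.Integer using (+_)
open import Data.List using (List; map; filter)
import Data.List.Membership.Propositional as List
open import Data.Nat using (ℕ; suc)
open import Data.Product using (_×_; ∃-syntax)
open import Data.Rational using (ℚ; _≤_; _+_; _-_; _/_; ∣_∣)
open import Data.Sum using (_⊎_)
open import Level using (0ℓ)
open import Relation.Binary.PropositionalEquality using (_≡_)
open import Relation.Nullary using (Dec; no; does; _×-dec_; _⊎-dec_; _→-dec_)
open import Relation.Unary using (Pred; _∈_; _⊆_)

infixr 7 _∧′_
infixr 6 _∨′_
infixr 5 _⇒_
infix  8 ¬′_
infix  4 _⊨_ _⊨?_ _⊨ˢ_ _∶_

data Formula (Atom : Set) : Set where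
  atom : Atom → Formula Atom
  ⊥′   : Formula Atom
  _∧′_ _∨′_ _⇒_ : Formula Atom → Formula Atom → Formula Atom

¬′_ : {Atom : Set} → Formula Atom → Formula Atom
¬′ F = F ⇒ ⊥′

-- A set of atoms is given by its characteristic function, so that every
-- formula is either satisfied or not and _⊨_ is classical satisfaction.
Interpretation : Set → Set
Interpretation Atom = Atom → Bool

⟦_⟧ : {Atom : Set} → Interpretation Atom → Pred Atom 0ℓ
⟦ X ⟧ a = T (X a)

_⊨_ : {Atom : Set} → Interpretation Atom → Formula Atom → Set
X ⊨ atom a   = a ∈ ⟦ X ⟧
X ⊨ ⊥′       = ⊥
X ⊨ (F ∧′ G) = X ⊨ F × X ⊨ G
X ⊨ (F ∨′ G) = X ⊨ F ⊎ X ⊨ G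
X ⊨ (F ⇒ G)  = X ⊨ F → X ⊨ G

_⊨?_ : {Atom : Set} (X : Interpretation Atom) (F : Formula Atom) → Dec (X ⊨ F)
X ⊨? atom a   = T? (X a)
X ⊨? ⊥′       = no λ ()
X ⊨? (F ∧′ G) = (X ⊨? F) ×-dec (X ⊨? G)
X ⊨? (F ∨′ G) = (X ⊨? F) ⊎-dec (X ⊨? G)
X ⊨? (F ⇒ G)  = (X ⊨? F) →-dec (X ⊨? G)

-- Going down from the root, the first unsatisfied subformulas met are
-- exactly the maximal ones; each is replaced by ⊥′.
reduct : {Atom : Set} → Interpretation Atom → Formula Atom → Formula Atom
reduct X F = if does (X ⊨? F) then descend F else ⊥′
  where
  descend : Formula _ → Formula _
  descend (atom a) = atom a
  descend ⊥′       = ⊥′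
  descend (F ∧′ G) = reduct X F ∧′ reduct X G
  descend (F ∨′ G) = reduct X F ∨′ reduct X G
  descend (F ⇒ G)  = reduct X F ⇒ reduct X G

FormulaSet : Set → Set₁
FormulaSet Atom = Pred (Formula Atom) 0ℓ

reductˢ : {Atom : Set} → Interpretation Atom → FormulaSet Atom → FormulaSet Atom
reductˢ X Γ G = ∃[ F ] F ∈ Γ × G ≡ reduct X F

_⊨ˢ_ : {Atom : Set} → Interpretation Atom → FormulaSet Atom → Set
X ⊨ˢ Γ = ∀ F → F ∈ Γ → X ⊨ F

MinimalModel : {Atom : Set} → FormulaSet Atom → Interpretation Atom → Set
MinimalModel Γ X = X ⊨ˢ Γ × (∀ Y → Y ⊨ˢ Γ → ⟦ Y ⟧ ⊆ ⟦ X ⟧ → ⟦ X ⟧ ⊆ ⟦ Y ⟧)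

StableModel : {Atom : Set} → FormulaSet Atom → Interpretation Atom → Set
StableModel Γ X = MinimalModel (reductˢ X Γ) X

choice : {Atom : Set} → Formula Atom → Formula Atom
choice F = F ∨′ ¬′ F

choiceˢ : {Atom : Set} → FormulaSet Atom → FormulaSet Atom
choiceˢ Γ G = ∃[ F ] F ∈ Γ × G ≡ choice F

-- Real numbers as regular sequences of rationals (Bishop).
record ℝ : Set where
  field
    seq     : ℕ → ℚ
    regular : ∀ m n → ∣ seq m - seq n ∣ ≤ (+ 1 / suc m) + (+ 1 / suc n)

data Weight : Set where
  real : ℝ → Weight
  α    : Weight

record WeightedFormula (Atom : Set) : Set where
  constructor _∶_
  field
    weight  : Weight
    formula : Formula Atom

open WeightedFormula public

-- A finite set, as the list of its elements; order and repetitions are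
-- irrelevant because programs are used only through membership.
Program : Set → Set
Program Atom = List (WeightedFormula Atom)

unweighted : {Atom : Set} → Program Atom → FormulaSet Atom
unweighted 𝔽 R = R List.∈ map formula 𝔽

satisfiedPart : {Atom : Set} → Program Atom → Interpretation Atom → Program Atom
satisfiedPart 𝔽 X = filter (λ wR → X ⊨? formula wR) 𝔽

SoftStableModel : {Atom : Set} → Program Atom → Interpretation Atom → Set
SoftStableModel 𝔽 X = StableModel (unweighted (satisfiedPart 𝔽 X)) X

{-# OPTIONS --safe #-}
-- Relative to X, the reduct of F ∨ ¬F says the same as the reduct of F when
-- X ⊨ F, and is a tautology otherwise.  So the reducts of the choice formulas
-- have the same models as the reduct of the part of 𝔽 satisfied by X.
module Submission where

open import Defs
open import Data.List.Membership.Propositional.Properties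
  using (∈-map⁺; ∈-map⁻; ∈-filter⁺; ∈-filter⁻)
open import Data.Product using (_×_; _,_)
open import Data.Sum using (inj₁; inj₂)
open import Function.Base using (id; _∘_)
open import Function.Bundles using (_⇔_; mk⇔; Equivalence)
open import Function.Construct.Symmetry using (⇔-sym)
open import Relation.Binary.PropositionalEquality using (refl)
open import Relation.Nullary using (yes; no; contradiction)
open import Relation.Unary using (_∈_)

open Equivalence using (to; from)

module _ {Atom : Set} where

  -- The implication covers both cases at once; its guard `X ⊨ F` is also the test that defines the
  -- satisfied part.
  ⊨-reduct-choice : (X Y : Interpretation Atom) (F : Formula Atom) →
    Y ⊨ reduct X (choice F) ⇔ (X ⊨ F → Y ⊨ reduct X F)
  ⊨-reduct-choice X Y F with X ⊨? F
  -- `X` falsifies `¬′ F`, whose reduct is therefore `⊥′`: only the left disjunct can hold.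
  ... | yes X⊨F = mk⇔ (λ { (inj₁ y) _ → y }) (λ f → inj₁ (f X⊨F))
  -- `F` reduces to `⊥′`, so `¬′ F` reduces to `⊥′ ⇒ ⊥′`, which `id` proves.
  ... | no  X⊭F = mk⇔ (λ _ X⊨F → contradiction X⊨F X⊭F) (λ _ → inj₂ id)

  ∈-satisfiedPart : (𝔽 : Program Atom) (X : Interpretation Atom) (F : Formula Atom) →
    F ∈ unweighted (satisfiedPart 𝔽 X) ⇔ (F ∈ unweighted 𝔽 × X ⊨ F)
  ∈-satisfiedPart 𝔽 X F = mk⇔ fwd bwd
    where
    X⊨? = λ wR → X ⊨? formula wR

    fwd : F ∈ unweighted (satisfiedPart 𝔽 X) → F ∈ unweighted 𝔽 × X ⊨ F
    fwd F∈ with ∈-map⁻ formula F∈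
    ... | wR , wR∈ , refl with ∈-filter⁻ X⊨? {xs = 𝔽} wR∈
    ...   | wR∈𝔽 , X⊨R = ∈-map⁺ formula wR∈𝔽 , X⊨R

    bwd : F ∈ unweighted 𝔽 × X ⊨ F → F ∈ unweighted (satisfiedPart 𝔽 X)
    bwd (F∈ , X⊨F) with ∈-map⁻ formula F∈
    -- Any weighted copy of `F` will do, since the filter ignores weights.
    ... | wR , wR∈𝔽 , refl = ∈-map⁺ formula (∈-filter⁺ X⊨? wR∈𝔽 X⊨F)

  ⊨ˢ-reductˢ-choiceˢ : (𝔽 : Program Atom) (X Y : Interpretation Atom) →
    Y ⊨ˢ reductˢ X (unweighted (satisfiedPart 𝔽 X)) ⇔
    Y ⊨ˢ reductˢ X (choiceˢ (unweighted 𝔽))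
  ⊨ˢ-reductˢ-choiceˢ 𝔽 X Y = mk⇔
    (λ { Y⊨ _ (_ , (F , F∈ , refl) , refl) →
         from (⊨-reduct-choice X Y F) λ X⊨F →
           Y⊨ _ (F , from (∈-satisfiedPart 𝔽 X F) (F∈ , X⊨F) , refl) })
    (λ { Y⊨ _ (F , F∈ , refl) →
         let F∈𝔽 , X⊨F = to (∈-satisfiedPart 𝔽 X F) F∈ in
         to (⊨-reduct-choice X Y F) (Y⊨ _ (choice F , (F , F∈𝔽 , refl) , refl)) X⊨F })

  -- Minimality depends on a set only through its models. Even one implication uses both directions
  -- of the equivalence: `X` passes from `Γ` to `Δ`, its competitors `Y` from `Δ` back to `Γ`.
  MinimalModel-resp-⇔ : {Γ Δ : FormulaSet Atom} → (∀ Y → Y ⊨ˢ Γ ⇔ Y ⊨ˢ Δ) →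
    ∀ X → MinimalModel Γ X → MinimalModel Δ X
  MinimalModel-resp-⇔ Γ⇔Δ X (X⊨Γ , minimal) =
    to (Γ⇔Δ X) X⊨Γ , λ Y → minimal Y ∘ from (Γ⇔Δ Y)

proposition4 : (Atom : Set) (𝔽 : Program Atom) (X : Interpretation Atom) →
    SoftStableModel 𝔽 X ⇔ StableModel (choiceˢ (unweighted 𝔽)) X
proposition4 Atom 𝔽 X = mk⇔
  (MinimalModel-resp-⇔ (⊨ˢ-reductˢ-choiceˢ 𝔽 X) X)
  (MinimalModel-resp-⇔ (⇔-sym ∘ ⊨ˢ-reductˢ-choiceˢ 𝔽 X) X)
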